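{- Let $f_n : X_n \to Y_n$ $(n\in\mathbb{N})$ be a family of exact proof tasks equipped with an evidence-retaining exact physical proof contract with finite work budget $B<\infty$, positive per-record cost floor $\varepsilon>0$, and retained-record lower-bound family $R:\mathbb{N}\to\mathbb{N}$. Suppose $R$ is unbounded, i.e. for every $K\in\mathbb{N}$ there is $n$ with $R(n)>K$. Then universal exact proof is unavailable within the contract: it is not the case that for every $n\in\mathbb{N}$ there exists an exact proof process for $f_n$ obeying the contract whose work is at most $B$.
   Context: An exact proof task at size $n$ is a function $f_n:X_n\to Y_n$ between finite sets ($X_n$ the admissible inputs, $Y_n$ the exact answers). An evidence-retaining exact physical proof contract for the family $(f_n)$ consists of: the task family with a finite query interface (finitely many locally readable finite-valued entries of each input) and a declared assignment of physical observables to these entries; a real work budget $B<\infty$, fixed independently of $n$; a real per-record cost floor $\varepsilon>0$ for irreversible evidence records; a function $R:\mathbb{N}\to\mathbb{N}$, the retained-record lower-bound family, such that every exact proof process for $f_n$ obeying the contract retains at least $R(n)$ records; and the separability convention that each retained record is a separate irreversible event, so that a process retaining $N$ records expends work $W\ge \varepsilon N$. Thus an exact proof process at size $n$ obeying the contract has a number of retained records $N\in\mathbb{N}$ and a work $W\in\mathbb{R}$ with $N\ge R(n)$ and $W\ge\varepsilon N$. Universal exact proof is available within the contract if for every $n$ there is such a process with $W\le B$. -}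

module Defs where

open import Data.Fin.Base using (Fin)
open import Data.Integer.Base using (+_)
open import Data.Nat.Base as ℕ using (ℕ)
import Data.Nat.Properties as ℕₚ
open import Data.Product.Base using (Σ; _×_; _,_; ∃-syntax)
open import Data.Rational.Base
  using (ℚ; 0ℚ; 1ℚ; _+_; _-_; _*_; -_; 1/_; ∣_∣; _/_; _≤_; _<_; NonZero; positive; nonNegative)
open import Data.Rational.Properties
open import Data.Rational.Solver using (module +-*-Solver)
open import Function.Bundles using (_↔_)
open import Relation.Binary.PropositionalEquality using (_≡_; refl; sym; trans; cong; subst)

Finite : Set → Set
Finite A = ∃[ k ] (A ↔ Fin k)

-- Real numbers as Cauchy sequences of rationals. Two sequences stand for the
-- same real when their difference tends to 0; the operations and relations
-- below respect this.

IsCauchy : (ℕ → ℚ) → Set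
IsCauchy x = ∀ δ → 0ℚ < δ → ∃[ M ] (∀ m n → M ℕ.≤ m → M ℕ.≤ n → ∣ x m - x n ∣ < δ)

record ℝ : Set where
  constructor mkℝ
  field
    seq    : ℕ → ℚ
    cauchy : IsCauchy seq

open ℝ public

private
  module _ where
    open +-*-Solver

    telescope : ∀ p q → p ≡ (p - q) + q
    telescope = solve 2 (λ p q → p := (p :+ :- q) :+ q) refl

    swap-* : ∀ s d i → s * (d * i) ≡ d * (s * i)
    swap-* = solve 3 (λ s d i → s :* (d :* i) := d :* (s :* i)) refl

    product-difference : ∀ p q r s → p * q - r * s ≡ p * (q - s) + s * (p - r)
    product-difference =
      solve 4 (λ p q r s → p :* q :+ :- (r :* s) := p :* (q :+ :- s) :+ s :* (p :+ :- r)) refl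

  eventually-bounded : ∀ x → IsCauchy x →
    ∃[ b ] (0ℚ < b × ∃[ M ] (∀ n → M ℕ.≤ n → ∣ x n ∣ ≤ b))
  eventually-bounded x c with c 1ℚ (positive⁻¹ 1ℚ)
  ... | M , close = 1ℚ + ∣ x M ∣ , 0<b , M , bound
    where
    open ≤-Reasoning
    0<b : 0ℚ < 1ℚ + ∣ x M ∣
    0<b = +-mono-<-≤ (positive⁻¹ 1ℚ) (0≤∣p∣ (x M))
    bound : ∀ n → M ℕ.≤ n → ∣ x n ∣ ≤ 1ℚ + ∣ x M ∣
    bound n M≤n = begin
      ∣ x n ∣                     ≡⟨ cong ∣_∣ (telescope (x n) (x M)) ⟩
      ∣ (x n - x M) + x M ∣       ≤⟨ ∣p+q∣≤∣p∣+∣q∣ (x n - x M) (x M) ⟩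
      ∣ x n - x M ∣ + ∣ x M ∣     ≤⟨ +-monoˡ-≤ ∣ x M ∣ (<⇒≤ (close n M M≤n ℕₚ.≤-refl)) ⟩
      1ℚ + ∣ x M ∣                ∎

  product-small : ∀ c p q η → 0ℚ < c → ∣ p ∣ ≤ c → ∣ q ∣ < η → ∣ p * q ∣ < c * η
  product-small c p q η 0<c p≤c q<η = begin-strict
    ∣ p * q ∣      ≡⟨ ∣p*q∣≡∣p∣*∣q∣ p q ⟩
    ∣ p ∣ * ∣ q ∣  ≤⟨ *-monoʳ-≤-nonNeg ∣ q ∣ {{nonNegative (0≤∣p∣ q)}} p≤c ⟩
    c * ∣ q ∣      <⟨ *-monoʳ-<-pos c {{positive 0<c}} q<η ⟩
    c * η          ∎
    where open ≤-Reasoning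

  product-close : ∀ a b η p q r s → 0ℚ < a → 0ℚ < b →
    ∣ p ∣ ≤ a → ∣ s ∣ ≤ b → ∣ p - r ∣ < η → ∣ q - s ∣ < η →
    ∣ p * q - r * s ∣ < (a + b) * η
  product-close a b η p q r s 0<a 0<b p≤a s≤b p-r<η q-s<η = begin-strict
    ∣ p * q - r * s ∣                      ≡⟨ cong ∣_∣ (product-difference p q r s) ⟩
    ∣ p * (q - s) + s * (p - r) ∣          ≤⟨ ∣p+q∣≤∣p∣+∣q∣ (p * (q - s)) (s * (p - r)) ⟩
    ∣ p * (q - s) ∣ + ∣ s * (p - r) ∣      <⟨ +-mono-< (product-small a p (q - s) η 0<a p≤a q-s<η)
                                                       (product-small b s (p - r) η 0<b s≤b p-r<η) ⟩
    a * η + b * η                          ≡⟨ sym (*-distribʳ-+ η a b) ⟩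
    (a + b) * η                            ∎
    where open ≤-Reasoning

  divide : ∀ c δ → 0ℚ < c → 0ℚ < δ → ∃[ η ] (0ℚ < η × c * η ≡ δ)
  divide c δ 0<c 0<δ = δ * 1/ c
    , positive⁻¹ (δ * 1/ c) {{pos*pos⇒pos δ {{positive 0<δ}} (1/ c) {{1/pos⇒pos c {{positive 0<c}}}}}}
    , trans (swap-* c δ (1/ c)) (trans (cong (δ *_) (*-inverseʳ c)) (*-identityʳ δ))
    where
    instance
      c≢0 : NonZero c
      c≢0 = pos⇒nonZero c {{positive 0<c}}

  unbound : ∀ i j k l {n} → (i ℕ.⊔ j) ℕ.⊔ (k ℕ.⊔ l) ℕ.≤ n →
    i ℕ.≤ n × j ℕ.≤ n × k ℕ.≤ n × l ℕ.≤ n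
  unbound i j k l {n} le =
      ℕₚ.m⊔n≤o⇒m≤o i j ij , ℕₚ.m⊔n≤o⇒n≤o i j ij , ℕₚ.m⊔n≤o⇒m≤o k l kl , ℕₚ.m⊔n≤o⇒n≤o k l kl
    where
    ij : i ℕ.⊔ j ℕ.≤ n
    ij = ℕₚ.m⊔n≤o⇒m≤o (i ℕ.⊔ j) (k ℕ.⊔ l) le
    kl : k ℕ.⊔ l ℕ.≤ n
    kl = ℕₚ.m⊔n≤o⇒n≤o (i ℕ.⊔ j) (k ℕ.⊔ l) le

  *-cauchy : ∀ x y → IsCauchy x → IsCauchy y → IsCauchy (λ n → x n * y n)
  *-cauchy x y cx cy δ 0<δ =
    let a , 0<a , Ma , boundx = eventually-bounded x cx
        b , 0<b , Mb , boundy = eventually-bounded y cy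
        η , 0<η , split = divide (a + b) δ (+-mono-< 0<a 0<b) 0<δ
        Mx , closex = cx η 0<η
        My , closey = cy η 0<η
    in (Ma ℕ.⊔ Mb) ℕ.⊔ (Mx ℕ.⊔ My) , λ m n M≤m M≤n →
      let am , _  , xm , ym = unbound Ma Mb Mx My M≤m
          _  , bn , xn , yn = unbound Ma Mb Mx My M≤n
      in subst (∣ x m * y m - x n * y n ∣ <_) split
           (product-close a b η (x m) (y m) (x n) (y n) 0<a 0<b
             (boundx m am) (boundy n bn) (closex m n xm xn) (closey m n ym yn))

fromℚ : ℚ → ℝ
fromℚ q = mkℝ (λ _ → q) (λ δ 0<δ → 0 , λ _ _ _ _ →
  subst (_< δ) (sym (cong ∣_∣ (+-inverseʳ q))) 0<δ)

fromℕ : ℕ → ℝ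
fromℕ n = fromℚ (+ n / 1)

0ℝ : ℝ
0ℝ = fromℚ 0ℚ

infixl 7 _*ℝ_
infix 4 _≤ℝ_ _<ℝ_

_*ℝ_ : ℝ → ℝ → ℝ
x *ℝ y = mkℝ (λ n → seq x n * seq y n) (*-cauchy (seq x) (seq y) (cauchy x) (cauchy y))

-- The slack δ is needed: termwise comparison would depend on the
-- representing sequence.
_≤ℝ_ : ℝ → ℝ → Set
x ≤ℝ y = ∀ δ → 0ℚ < δ → ∃[ M ] (∀ n → M ℕ.≤ n → seq x n ≤ seq y n + δ)

_<ℝ_ : ℝ → ℝ → Set
x <ℝ y = ∃[ δ ] (0ℚ < δ × ∃[ M ] (∀ n → M ℕ.≤ n → seq x n + δ ≤ seq y n))

record TaskFamily : Set₁ where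
  field
    X        : ℕ → Set
    Y        : ℕ → Set
    X-finite : ∀ n → Finite (X n)
    Y-finite : ∀ n → Finite (Y n)
    f        : ∀ n → X n → Y n

record QueryInterface (T : TaskFamily) : Set₁ where
  open TaskFamily T
  field
    entries      : ℕ → ℕ
    Value        : ∀ n → Fin (entries n) → Set
    Value-finite : ∀ n i → Finite (Value n i)
    read         : ∀ n (i : Fin (entries n)) → X n → Value n i

record Contract (T : TaskFamily) : Set₁ where
  open TaskFamily T
  field
    interface : QueryInterface T

  open QueryInterface interface public

  field
    Observable : Set
    observable : ∀ n → Fin (entries n) → Observable

    B   : ℝ
    ε   : ℝ
    0<ε : 0ℝ <ℝ ε
    R   : ℕ → ℕ

    -- Physical processes run on size-n inputs, kept abstract: the mathematics
    -- only uses the answers a process gives, the number of records it retains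
    -- and the work it expends.
    Process  : ℕ → Set
    answer   : ∀ {n} → Process n → X n → Y n
    retained : ∀ {n} → Process n → ℕ
    work     : ∀ {n} → Process n → ℝ
    Obeys    : ∀ {n} → Process n → Set

  Exact : ∀ {n} → Process n → Set
  Exact {n} p = ∀ x → answer p x ≡ f n x

  field
    retention    : ∀ {n} (p : Process n) → Exact p → Obeys p → R n ℕ.≤ retained p
    -- Each retained record is a separate irreversible event of cost at least ε.
    separability : ∀ {n} (p : Process n) → Obeys p → ε *ℝ fromℕ (retained p) ≤ℝ work p

Unbounded : (ℕ → ℕ) → Set
Unbounded R = ∀ K → ∃[ n ] R n ℕ.> K

UniversalExactProofAvailable : {T : TaskFamily} → Contract T → Set
UniversalExactProofAvailable C =
  ∀ n → Σ (Process n) λ p → Exact p × Obeys p × work p ≤ℝ B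
  where open Contract C

{-# OPTIONS --safe #-}

module Submission where

open import Defs
open import Relation.Nullary using (¬_)
open import Data.Integer.Base as ℤ using (+_)
import Data.Integer.Properties as ℤₚ
open import Data.Nat.Base as ℕ using (_⊔_)
import Data.Nat.Properties as ℕₚ
open import Data.Product.Base using (_,_; ∃-syntax)
open import Data.Sum.Base using (inj₁; inj₂)
open import Data.Rational.Base
  using (0ℚ; 1ℚ; _+_; _-_; _*_; -_; 1/_; ∣_∣; _/_; _≤_; _<_; ↥_; ↧_; ↧ₙ_; mkℚ; NonZero; Positive; positive)
open import Data.Rational.Properties
open import Data.Rational.Solver using (module +-*-Solver)
import Data.Rational.Unnormalised.Base as ℚᵘ
import Data.Rational.Unnormalised.Properties as ℚᵘₚ
open import Relation.Binary.PropositionalEquality using (_≡_; refl; sym; trans; cong; subst)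

-- Budget and cost floor are fixed while the number of retained records is not, so the Archimedean
-- property decides: some `K`, depending only on `ε` and `B`, makes `ε` times any `N > K` exceed
-- `B`. At a size with `R n > K`, the work of an exact process obeying the contract therefore
-- exceeds the budget. `multiples-exceed` is this property for Cauchy reals. It reduces to the
-- rational case `archimedean-*` by replacing `ε` with a positive rational lower bound and `B` with
-- a rational upper bound from `eventually-bounded-above`.

i≤∣i∣ : ∀ i → i ℤ.≤ + ℤ.∣ i ∣
i≤∣i∣ (+ n)        = ℤₚ.≤-refl
i≤∣i∣ (ℤ.-[1+ n ]) = ℤ.-≤+

-- The denominator is at least 1, so the absolute value of the numerator already bounds `q`.
archimedean : ∀ q → ∃[ K ] (∀ N → K ℕ.< N → q < + N / 1)
archimedean q@(mkℚ _ _ _) = ℤ.∣ ↥ q ∣ , λ N K<N → toℚᵘ-cancel-<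
  -- `+ N / 1` is `fromℚᵘ` of the unnormalised fraction `N` over 1 (the `0` stores the denominator
  -- minus one), so the comparison becomes the cross-multiplication `cross`.
  (ℚᵘₚ.<-respʳ-≃ (ℚᵘₚ.≃-sym (toℚᵘ-fromℚᵘ (ℚᵘ.mkℚᵘ (+ N) 0))) (ℚᵘ.*<* (cross N K<N)))
  where
  open ℤₚ.≤-Reasoning
  cross : ∀ N → ℤ.∣ ↥ q ∣ ℕ.< N → ↥ q ℤ.* + 1 ℤ.< + N ℤ.* ↧ q
  cross N K<N = begin-strict
    ↥ q ℤ.* + 1        ≡⟨ ℤₚ.*-identityʳ (↥ q) ⟩
    ↥ q                ≤⟨ i≤∣i∣ (↥ q) ⟩
    + ℤ.∣ ↥ q ∣        <⟨ ℤ.+<+ K<N ⟩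
    + N                ≤⟨ ℤ.+≤+ (ℕₚ.m≤m*n N (↧ₙ q)) ⟩
    + (N ℕ.* ↧ₙ q)     ≡⟨ ℤₚ.pos-* N (↧ₙ q) ⟩
    + N ℤ.* ↧ q        ∎

archimedean-* : ∀ d c → 0ℚ < d → ∃[ K ] (∀ N → K ℕ.< N → c < d * (+ N / 1))
archimedean-* d c 0<d =
  let K , large = archimedean (1/ d * c)
  in K , λ N K<N → subst (_< d * (+ N / 1)) cancel (*-monoʳ-<-pos d (large N K<N))
  where
  instance
    d>0 : Positive d
    d>0 = positive 0<d
    d≢0 : NonZero d
    d≢0 = pos⇒nonZero d
  cancel : d * (1/ d * c) ≡ c
  cancel = trans (sym (*-assoc d (1/ d) c)) (trans (cong (_* c) (*-inverseʳ d)) (*-identityˡ c))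

p≤∣p∣ : ∀ p → p ≤ ∣ p ∣
p≤∣p∣ p with ≤-total 0ℚ p
... | inj₁ 0≤p = ≤-reflexive (sym (0≤p⇒∣p∣≡p 0≤p))
... | inj₂ p≤0 = ≤-trans p≤0 (0≤∣p∣ p)

-- Past the Cauchy index for tolerance 1, every term lies within 1 of `seq x M`.
eventually-bounded-above : ∀ x → ∃[ b ] ∃[ M ] (∀ n → M ℕ.≤ n → seq x n ≤ b)
eventually-bounded-above x with cauchy x 1ℚ (positive⁻¹ 1ℚ)
... | M , close = 1ℚ + seq x M , M , λ n M≤n → begin
    seq x n                          ≡⟨ telescope (seq x n) (seq x M) ⟩
    (seq x n - seq x M) + seq x M    ≤⟨ +-monoˡ-≤ (seq x M) (p≤∣p∣ (seq x n - seq x M)) ⟩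
    ∣ seq x n - seq x M ∣ + seq x M  ≤⟨ +-monoˡ-≤ (seq x M) (<⇒≤ (close n M M≤n ℕₚ.≤-refl)) ⟩
    1ℚ + seq x M                     ∎
  where
  open ≤-Reasoning
  open +-*-Solver
  telescope : ∀ p q → p ≡ (p - q) + q
  telescope = solve 2 (λ p q → p := (p :+ :- q) :+ q) refl
-- Unfolding x N ≤ z ≤ y with slack 1 at each step at a late common index gives
-- d N ≤ b + 2, where d > 0 is the gap witnessing 0 < x and b bounds y from above.
multiples-exceed : ∀ x y → 0ℝ <ℝ x →
  ∃[ K ] (∀ N z → K ℕ.< N → x *ℝ fromℕ N ≤ℝ z → ¬ z ≤ℝ y)
multiples-exceed x y (d , 0<d , Mx , x≥d) =
  let b , My , y≤b = eventually-bounded-above y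
      K , large = archimedean-* d ((b + 1ℚ) + 1ℚ) 0<d
  in K , λ N z K<N xN≤z z≤y →
    let M₁ , xN≤z+1 = xN≤z 1ℚ (positive⁻¹ 1ℚ)
        M₂ , z≤y+1 = z≤y 1ℚ (positive⁻¹ 1ℚ)
        n = (Mx ⊔ My) ⊔ (M₁ ⊔ M₂)
        xy≤n = ℕₚ.m≤m⊔n (Mx ⊔ My) (M₁ ⊔ M₂)
        zz≤n = ℕₚ.m≤n⊔m (Mx ⊔ My) (M₁ ⊔ M₂)
        d≤x = subst (_≤ seq x n) (+-identityˡ d) (x≥d n (ℕₚ.m⊔n≤o⇒m≤o Mx My xy≤n))
    in <-irrefl refl (begin-strict
      (b + 1ℚ) + 1ℚ        <⟨ large N K<N ⟩
      d * (+ N / 1)        ≤⟨ *-monoʳ-≤-nonNeg (+ N / 1) {{normalize-nonNeg N 1}} d≤x ⟩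
      seq x n * (+ N / 1)  ≤⟨ xN≤z+1 n (ℕₚ.m⊔n≤o⇒m≤o M₁ M₂ zz≤n) ⟩
      seq z n + 1ℚ         ≤⟨ +-monoˡ-≤ 1ℚ (z≤y+1 n (ℕₚ.m⊔n≤o⇒n≤o M₁ M₂ zz≤n)) ⟩
      (seq y n + 1ℚ) + 1ℚ  ≤⟨ +-monoˡ-≤ 1ℚ (+-monoˡ-≤ 1ℚ (y≤b n (ℕₚ.m⊔n≤o⇒n≤o Mx My xy≤n))) ⟩
      (b + 1ℚ) + 1ℚ        ∎)
  where open ≤-Reasoning

theorem5p2 : (T : TaskFamily) (C : Contract T) → Unbounded (Contract.R C) → ¬ UniversalExactProofAvailable C
theorem5p2 T C unbounded available =
  let open Contract C
      K , exceed = multiples-exceed ε B 0<ε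
      -- `K` comes from `ε` and `B` alone, so the size can be fixed before any process is
      -- considered.
      n , K<R = unbounded K
      p , exact , obeys , work≤B = available n
  in exceed (retained p) (work p) (ℕₚ.<-≤-trans K<R (retention p exact obeys)) (separability p obeys) work≤B
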